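{- Let $n\geq 1$ and let $\varphi=\frac{1+\sqrt5}{2}$. If ${\bf f}[n]=a$, then $V(n)=\lceil n/\varphi^2\rceil$, equivalently $V(n)$ equals the number of occurrences of $b$ in ${\bf f}(0..n]$ plus one. If ${\bf f}[n]=b$, then $V(n)=\lceil n/\varphi^3\rceil$, equivalently $V(n)$ equals the number of occurrences of the factor $aa$ in ${\bf f}(0..n]$ plus one.
   Context: Fibonacci numbers: $F_0=0$, $F_1=1$, $F_{m+2}=F_{m+1}+F_m$. Standard Fibonacci words over $\{a,b\}$: $f_{ -1}=b$, $f_0=a$, $f_{m+1}=f_mf_{m-1}$ for $m\geq 0$ (so $|f_m|=F_{m+2}$). The Fibonacci infinite word is ${\bf f}=\lim_{m\to\infty} f_m=abaababaab\cdots$, indexed from ${\bf f}[1]=a$; ${\bf f}(0..j]$ denotes its prefix of length $j$. For nonnegative integers $k_m,\dots,k_0$, $[k_m\cdots k_0]_F$ denotes $\sum_{i=0}^m k_iF_{i+2}$. A representation $N=[k_m\cdots k_0]_F$ with all $k_i\geq 0$ is valid if ${\bf f}(0..N]=f_m^{k_m}\cdots f_0^{k_0}$. $V(N)$ denotes the number of valid representations of $N$ (up to leading zeros), i.e. the number of factorizations of ${\bf f}(0..N]$ as a concatenation $f_m^{k_m}\cdots f_0^{k_0}$ of standard words $f_i$, $i\geq 0$, in non-strictly decreasing order of index; $V(0)=1$. -}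

module Defs where

open import Data.Empty using (⊥-elim)
open import Data.Fin.Base using (Fin; zero; suc; fromℕ<)
open import Data.Integer.Base as ℤ using (ℤ; +_)
open import Data.Irrelevant using (Irrelevant; [_])
open import Data.List.Base
  using (List; []; _∷_; _++_; length; lookup; concat; replicate; filter; tails;
         applyUpTo; upTo; cartesianProductWith)
open import Data.List.Membership.Propositional using (_∈_)
open import Data.List.Membership.Propositional.Properties
  using (∈-cartesianProductWith⁺; ∈-cartesianProductWith⁻; ∈-upTo⁺; ∈-filter⁺; ∈-filter⁻; ∈-lookup)
open import Data.List.Properties using (≡-dec; length-++; ∷-injective)
open import Data.List.Relation.Binary.Prefix.Heterogeneous using (Prefix)
open import Data.List.Relation.Binary.Prefix.Heterogeneous.Properties using (prefix?)
open import Data.List.Relation.Unary.All as All using (All; []; _∷_)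
open import Data.List.Relation.Unary.AllPairs using ([]; _∷_)
open import Data.List.Relation.Unary.Any as Any using (here; there)
open import Data.List.Relation.Unary.Any.Properties using (lookup-index)
open import Data.List.Relation.Unary.Unique.Propositional using (Unique)
import Data.List.Relation.Unary.Unique.Propositional.Properties as Unique
open import Data.Nat.Base using (ℕ; zero; suc)
open import Data.Product.Base using (∃; _×_; _,_; proj₁; proj₂)
open import Data.Rational.Base as ℚ using (ℚ; 0ℚ; 1ℚ)
open import Data.Refinement.Base using (Refinement; _,_; Refinement-syntax)
open import Data.Sum.Base using (inj₁; inj₂)
open import Data.Unit.Base using (⊤; tt)
open import Function.Base using (_∘_)
open import Function.Bundles using (_↔_; mk↔ₛ′)
open import Relation.Binary.Definitions using (DecidableEquality)
open import Relation.Binary.PropositionalEquality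
  using (_≡_; refl; sym; trans; cong; cong₂; subst; module ≡-Reasoning)
open import Relation.Nullary.Decidable using (Dec; yes; no; recompute; _×-dec_)

-- The exact subfield of ℝ in which n/φ² and n/φ³ live, with the order
-- induced by √5 > 0.

module ℚ[√5] where

  infixl 6 _+_ _-_
  infixl 7 _*_ _÷_
  infixr 8 _^_
  infix  4 _≤_
  infix  5 _+√5·_

  record ℚ√5 : Set where
    constructor _+√5·_
    field
      rat irr : ℚ

  fromℤ : ℤ → ℚ√5
  fromℤ k = (k ℚ./ 1) +√5· 0ℚ

  fromℕ : ℕ → ℚ√5
  fromℕ n = fromℤ (+ n)

  √5 : ℚ√5
  √5 = 0ℚ +√5· 1ℚ

  _+_ _-_ _*_ : ℚ√5 → ℚ√5 → ℚ√5
  (p +√5· q) + (r +√5· s) = (p ℚ.+ r) +√5· (q ℚ.+ s)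
  (p +√5· q) - (r +√5· s) = (p ℚ.- r) +√5· (q ℚ.- s)
  (p +√5· q) * (r +√5· s) =
    (p ℚ.* r ℚ.+ (+ 5 ℚ./ 1) ℚ.* (q ℚ.* s)) +√5· (p ℚ.* s ℚ.+ q ℚ.* r)

  norm : ℚ√5 → ℚ
  norm (p +√5· q) = p ℚ.* p ℚ.- (+ 5 ℚ./ 1) ℚ.* (q ℚ.* q)

  -- 1/(p + q√5) = (p - q√5)/(p² - 5q²)
  _⁻¹ : (x : ℚ√5) → .{{_ : ℚ.NonZero (norm x)}} → ℚ√5
  x@(p +√5· q) ⁻¹ = (p ℚ.÷ norm x) +√5· ((ℚ.- q) ℚ.÷ norm x)

  _÷_ : (x y : ℚ√5) → .{{_ : ℚ.NonZero (norm y)}} → ℚ√5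
  x ÷ y = x * (y ⁻¹)

  _^_ : ℚ√5 → ℕ → ℚ√5
  x ^ zero  = fromℕ 1
  x ^ suc n = x * x ^ n

  φ : ℚ√5
  φ = (fromℕ 1 + √5) ÷ fromℕ 2

  -- p + q√5 ≥ 0.  When p and q have opposite signs, compare p² with (q√5)²;
  -- when both are negative the sum is negative.
  data NonNegative : ℚ√5 → Set where
    both≥0 : ∀ {p q} → 0ℚ ℚ.≤ p → 0ℚ ℚ.≤ q → NonNegative (p +√5· q)
    irr≤0  : ∀ {p q} → 0ℚ ℚ.≤ p → q ℚ.≤ 0ℚ →
             (+ 5 ℚ./ 1) ℚ.* (q ℚ.* q) ℚ.≤ p ℚ.* p → NonNegative (p +√5· q)
    rat≤0  : ∀ {p q} → p ℚ.≤ 0ℚ → 0ℚ ℚ.≤ q →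
             p ℚ.* p ℚ.≤ (+ 5 ℚ./ 1) ℚ.* (q ℚ.* q) → NonNegative (p +√5· q)

  _≤_ : ℚ√5 → ℚ√5 → Set
  x ≤ y = NonNegative (y - x)

  -- k = ⌈x⌉
  IsCeiling : ℚ√5 → ℤ → Set
  IsCeiling x k = x ≤ fromℤ k × (∀ j → x ≤ fromℤ j → k ℤ.≤ j)

  _ : √5 * √5 ≡ fromℕ 5
  _ = refl

  _ : φ * φ ≡ φ + fromℕ 1
  _ = refl

  _ : (fromℕ 1 ÷ φ ^ 3) * φ ^ 3 ≡ fromℕ 1
  _ = refl

open import Data.Nat.Base
open import Data.Nat.Properties

F : ℕ → ℕ
F 0             = 0
F 1             = 1
F (suc (suc m)) = F (suc m) + F m

data Letter : Set where
  a b : Letter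

_≟ᴸ_ : DecidableEquality Letter
a ≟ᴸ a = yes refl
a ≟ᴸ b = no λ ()
b ≟ᴸ a = no λ ()
b ≟ᴸ b = yes refl

f₋₁ : List Letter
f₋₁ = b ∷ []

f : ℕ → List Letter
f 0             = a ∷ []
f 1             = f 0 ++ f₋₁
f (suc (suc m)) = f (suc m) ++ f m

private
  1≤|f| : ∀ m → 1 ≤ length (f m)
  1≤|f| 0             = s≤s z≤n
  1≤|f| 1             = s≤s z≤n
  1≤|f| (suc (suc m)) = subst (1 ≤_) (sym (length-++ (f (suc m))))
    (≤-trans (1≤|f| (suc m)) (m≤m+n _ _))

m<|f| : ∀ m → m < length (f m)
m<|f| 0             = s≤s z≤n
m<|f| 1             = s≤s (s≤s z≤n)
m<|f| (suc (suc m)) = subst (suc (suc (suc m)) ≤_) (sym (length-++ (f (suc m))))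
  (subst (_≤ length (f (suc m)) + length (f m)) (+-comm (suc (suc m)) 1)
    (+-mono-≤ (m<|f| (suc m)) (1≤|f| m)))

-- The n-th letter of the infinite word, counting from n = 1.  It is read off
-- f (n - 1), which has at least n letters; `prefix-f` below shows that the
-- choice does not matter, i.e. that every f m is a prefix of 𝐟.
𝐟 : (n : ℕ) → .{{_ : NonZero n}} → Letter
𝐟 (suc j) = lookup (f j) (fromℕ< (m<|f| j))

-- 𝐟(0..n]
prefix : ℕ → List Letter
prefix n = applyUpTo (λ j → 𝐟 (suc j)) n

private
  at : ∀ {A : Set} (xs : List A) j → .(j < length xs) → A
  at xs j p = lookup xs (fromℕ< p)

  at-++ : ∀ {A : Set} (xs ys : List A) j .(p : j < length xs) .(q : j < length (xs ++ ys)) →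
          at (xs ++ ys) j q ≡ at xs j p
  at-++ []       ys j       p q = ⊥-elim (recomputed p)
    where
    recomputed : .(j < 0) → _
    recomputed ()
  at-++ (x ∷ xs) ys zero    p q = refl
  at-++ (x ∷ xs) ys (suc j) p q = at-++ xs ys j (s≤s⁻¹ p) (s≤s⁻¹ q)

  |f|-suc : ∀ m → length (f m) ≤ length (f (suc m))
  |f|-suc zero    = s≤s z≤n
  |f|-suc (suc m) = subst (length (f (suc m)) ≤_) (sym (length-++ (f (suc m)))) (m≤m+n _ _)

  at-suc : ∀ m j .(p : j < length (f m)) .(q : j < length (f (suc m))) →
           at (f (suc m)) j q ≡ at (f m) j p
  at-suc zero    j p q = at-++ (f 0) f₋₁ j p q
  at-suc (suc m) j p q = at-++ (f (suc m)) (f m) j p q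

  |f|-mono : ∀ {m k} → m ≤′ k → length (f m) ≤ length (f k)
  |f|-mono ≤′-refl       = ≤-refl
  |f|-mono (≤′-step {k} m≤k) = ≤-trans (|f|-mono m≤k) (|f|-suc k)

  at-mono : ∀ {m k} → m ≤′ k → ∀ j .(p : j < length (f m)) .(q : j < length (f k)) →
            at (f k) j q ≡ at (f m) j p
  at-mono ≤′-refl                   j p q = refl
  at-mono {m} (≤′-step {k} m≤k) j p q =
    trans (at-suc k j (<-≤-trans p (|f|-mono m≤k)) q) (at-mono m≤k j p _)

  applyUpTo-at : ∀ {A : Set} (g : ℕ → A) xs →
                 (∀ j .(p : j < length xs) → g j ≡ at xs j p) →
                 applyUpTo g (length xs) ≡ xs
  applyUpTo-at g []       h = refl
  applyUpTo-at g (x ∷ xs) h =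
    cong₂ _∷_ (h 0 (s≤s z≤n)) (applyUpTo-at (g ∘ suc) xs λ j p → h (suc j) (s≤s p))

prefix-f : ∀ m → prefix (length (f m)) ≡ f m
prefix-f m = applyUpTo-at _ (f m) λ j p → same j p (≤-total j m)
  where
  same : ∀ j .(p : j < length (f m)) → _ → 𝐟 (suc j) ≡ at (f m) j p
  same j p (inj₁ j≤m) = sym (at-mono (≤⇒≤′ j≤m) j (m<|f| j) p)
  same j p (inj₂ m≤j) = at-mono (≤⇒≤′ m≤j) j p (m<|f| j)

-- The number of positions of w at which the (non-empty) word u occurs;
-- occurrences may overlap.
occurrences : List Letter → List Letter → ℕ
occurrences u w = length (filter (prefix? _≟ᴸ_ u) (tails w))

-- A representation k_m ⋯ k_0 is the list k_m ∷ ⋯ ∷ k_0 ∷ [], so the index of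
-- the leading digit is the length of the rest of the list.

[_]F : List ℕ → ℕ
[ []     ]F = 0
[ k ∷ ks ]F = k * F (length ks + 2) + [ ks ]F

_^ʷ_ : List Letter → ℕ → List Letter
w ^ʷ k = concat (replicate k w)

-- f_m^{k_m} ⋯ f_0^{k_0}
word : List ℕ → List Letter
word []       = []
word (k ∷ ks) = (f (length ks) ^ʷ k) ++ word ks

Valid : ℕ → List ℕ → Set
Valid N ks = N ≡ [ ks ]F × prefix N ≡ word ks

NoLeadingZero : List ℕ → Set
NoLeadingZero []       = ⊤
NoLeadingZero (k ∷ ks) = NonZero k

-- Identifying representations up to leading zeros amounts to keeping only
-- those without leading zeros.  The proofs are irrelevant, so two elements are
-- equal as soon as their digits are.
ValidRep : ℕ → Set
ValidRep N = [ ks ∈ List ℕ ∣ NoLeadingZero ks × Valid N ks ]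

private
  noLeadingZero? : ∀ ks → Dec (NoLeadingZero ks)
  noLeadingZero? []           = yes tt
  noLeadingZero? (zero ∷ ks)  = no λ ()
  noLeadingZero? (suc k ∷ ks) = yes _

  rep? : ∀ N ks → Dec (NoLeadingZero ks × Valid N ks)
  rep? N ks = noLeadingZero? ks ×-dec
    (N ≟ [ ks ]F) ×-dec ≡-dec _≟ᴸ_ (prefix N) (word ks)

  bounded : ℕ → ℕ → List (List ℕ)
  bounded c zero    = [] ∷ []
  bounded c (suc l) = [] ∷ cartesianProductWith _∷_ (upTo c) (bounded c l)

  bounded-unique : ∀ c l → Unique (bounded c l)
  bounded-unique c zero    = [] ∷ []
  bounded-unique c (suc l) =
    All.tabulate (λ { x∈ refl → case x∈ })
    ∷ Unique.cartesianProductWith⁺ _∷_ ∷-injective (Unique.upTo⁺ c) (bounded-unique c l)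
    where
    case : [] ∈ cartesianProductWith _∷_ (upTo c) (bounded c l) → _
    case x∈ with ∈-cartesianProductWith⁻ _∷_ (upTo c) (bounded c l) x∈
    ... | _ , _ , _ , _ , ()

  bounded-complete : ∀ {c} l ks → length ks ≤ l → All (_< c) ks → ks ∈ bounded c l
  bounded-complete zero    []       _       _        = here refl
  bounded-complete (suc l) []       _       _        = here refl
  bounded-complete (suc l) (k ∷ ks) (s≤s p) (q ∷ qs) =
    there (∈-cartesianProductWith⁺ _∷_ (∈-upTo⁺ q) (bounded-complete l ks p qs))

  1≤F : ∀ m → 1 ≤ F (suc m)
  1≤F zero    = s≤s z≤n
  1≤F (suc m) = ≤-trans (1≤F m) (m≤m+n _ _)

  m<F : ∀ m → m < F (suc (suc m))
  m<F zero    = s≤s z≤n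
  m<F (suc m) = subst (_≤ F (suc (suc m)) + F (suc m)) (+-comm (suc m) 1)
    (+-mono-≤ (m<F m) (1≤F m))

  F-+2 : ∀ m → F (m + 2) ≡ F (suc (suc m))
  F-+2 m = cong F (+-comm m 2)

  digits-bounded : ∀ ks → All (_≤ [ ks ]F) ks
  digits-bounded []       = []
  digits-bounded (k ∷ ks) =
    ≤-trans (≤-trans (≤-reflexive (sym (*-identityʳ k)))
                     (*-monoʳ-≤ k (subst (1 ≤_) (sym (F-+2 (length ks))) (1≤F (suc (length ks))))))
            (m≤m+n _ _)
    ∷ All.map (λ p → ≤-trans p (m≤n+m _ _)) (digits-bounded ks)

  length-bounded : ∀ ks → NoLeadingZero ks → length ks ≤ [ ks ]F
  length-bounded []           _ = z≤n
  length-bounded (suc k ∷ ks) _ =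
    ≤-trans (subst (length ks <_) (sym (F-+2 (length ks))) (m<F _))
            (≤-trans (m≤m+n _ _) (m≤m+n _ _))

  reps : ℕ → List (List ℕ)
  reps N = filter (rep? N) (bounded (suc N) N)

  reps-complete : ∀ {N} ks → NoLeadingZero ks × Valid N ks → ks ∈ reps N
  reps-complete {N} ks p@(nz , refl , _) =
    ∈-filter⁺ (rep? N) (bounded-complete N ks (length-bounded ks nz)
                                         (All.map s≤s (digits-bounded ks))) p

  lookup-injective : ∀ {A : Set} {xs : List A} → Unique xs →
                     ∀ i j → lookup xs i ≡ lookup xs j → i ≡ j
  lookup-injective (x∉ ∷ u) zero    zero    eq = refl
  lookup-injective (x∉ ∷ u) zero    (suc j) eq = ⊥-elim (All.lookup x∉ (∈-lookup j) eq)
  lookup-injective (x∉ ∷ u) (suc i) zero    eq = ⊥-elim (All.lookup x∉ (∈-lookup i) (sym eq))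
  lookup-injective (x∉ ∷ u) (suc i) (suc j) eq = cong suc (lookup-injective u i j eq)

  ValidRep-≡ : ∀ {N} {r s : ValidRep N} → Refinement.value r ≡ Refinement.value s → r ≡ s
  ValidRep-≡ refl = refl

validRep-finite : ∀ N → ∃ λ v → Fin v ↔ ValidRep N
validRep-finite N = length (reps N) , mk↔ₛ′ to from to-from from-to
  where
  to : Fin (length (reps N)) → ValidRep N
  to i = lookup (reps N) i , [ proj₂ (∈-filter⁻ (rep? N) {xs = bounded (suc N) N} (∈-lookup i)) ]

  mem : (r : ValidRep N) → Refinement.value r ∈ reps N
  mem (ks , [ p ]) = reps-complete ks (recompute (rep? N ks) p)

  from : ValidRep N → Fin (length (reps N))
  from r = Any.index (mem r)

  to-from : ∀ r → to (from r) ≡ r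
  to-from r = ValidRep-≡ (sym (lookup-index (mem r)))

  from-to : ∀ i → from (to i) ≡ i
  from-to i = lookup-injective (Unique.filter⁺ (rep? N) (bounded-unique (suc N) N)) _ _
    (sym (lookup-index (mem (to i))))

V : ℕ → ℕ
V N = proj₁ (validRep-finite N)

{-# OPTIONS --safe #-}

-- 𝐟 is fixed by the substitution h : a ↦ ab, b ↦ a, and f (m + 1) = h (f m), so
-- word (ks ∷ʳ k) = h (word ks) aᵏ.  Hence the number T w of representations whose
-- word is w satisfies, for arbitrary words,
--   T (h (va)) = T (va),  T (h (vb)) = T (vb) + T (h v),  T b = T (⋯bb) = 0.
-- Now T is computed along the prefixes of 𝐟 from how each is desubstituted.
-- For the ceilings, let A and B count the letters a and b in a prefix.  Since h
-- multiplies A − Bφ by −1/φ, this quantity stays in intervals that depend only on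
-- the next letter.

module Submission where

open import Defs
open import Data.Empty using (⊥; ⊥-elim)
open import Data.Empty.Irrelevant using () renaming (⊥-elim to ⊥-elim-irr)
open import Data.Fin.Base using (Fin)
open import Data.Fin.Permutation using (↔⇒≡)
open import Data.Fin.Properties using (0↔⊥; 1↔⊤; +↔⊎)
open import Data.Integer.Base as ℤ using (ℤ; +_; -[1+_])
import Data.Integer.Properties as ℤ
open import Data.Irrelevant using ([_])
open import Data.List.Base
  using (List; []; _∷_; _++_; _∷ʳ_; _ʳ++_; length; reverse; replicate; applyUpTo)
open import Data.List.Properties
  using (∷-injectiveˡ; ∷-injectiveʳ; length-++; length-reverse; length-applyUpTo; applyUpTo-∷ʳ;
         ʳ++-defn; reverse-++; reverse-involutive; unfold-reverse; ++-assoc; ++-identityʳ)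
open import Data.Nat.Base
  using (ℕ; zero; suc; _+_; _*_; _≤_; _<_; z≤n; s≤s; s≤s⁻¹; NonZero)
open import Data.Nat.Coprimality using (Coprime; 1-coprimeTo) renaming (sym to coprime-sym)
open import Data.Nat.Properties
open import Data.Nat.Tactic.RingSolver using (solve-∀)
open import Data.Product.Base using (∃; ∃₂; _×_; _,_; proj₁; proj₂)
open import Data.Rational.Base as ℚ using (ℚ; 0ℚ; 1ℚ; ½; mkℚ)
import Data.Rational.Properties as ℚ
open import Data.Rational.Solver using (module +-*-Solver)
open import Data.Refinement.Base using (_,_; Refinement-syntax; value)
open import Data.Sum.Base using (_⊎_; inj₁; inj₂)
open import Data.Sum.Function.Propositional using (_⊎-↔_)
open import Data.Unit.Base using (⊤; tt)
open import Function.Base using (_∘_)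
open import Function.Bundles using (_↔_; mk↔ₛ′)
open import Function.Properties.Inverse using (↔-refl; ↔-sym; ↔-trans)
open import Relation.Binary.PropositionalEquality
open import Relation.Nullary.Negation.Core using (¬_)
open ℚ[√5]
  using (fromℕ; fromℤ; φ; _÷_; _^_; IsCeiling; NonNegative; both≥0; irr≤0; rat≤0; _+√5·_)
  renaming (_≤_ to infix 4 _≤√5_)

-- Representations as digit lists, and the recurrences for their number

Word : Set
Word = List Letter

-- h on reversed words: in σ, val, Rep, Pre and count the head of a list is the last letter.
σ : Word → Word
σ []      = []
σ (a ∷ w) = b ∷ a ∷ σ w
σ (b ∷ w) = a ∷ σ w

σ-injective : ∀ u v → σ u ≡ σ v → u ≡ v
σ-injective []      []      eq = refl
σ-injective []      (a ∷ v) ()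
σ-injective []      (b ∷ v) ()
σ-injective (a ∷ u) []      ()
σ-injective (b ∷ u) []      ()
σ-injective (a ∷ u) (a ∷ v) eq = cong (a ∷_) (σ-injective u v (∷-injectiveʳ (∷-injectiveʳ eq)))
σ-injective (a ∷ u) (b ∷ v) ()
σ-injective (b ∷ u) (a ∷ v) ()
σ-injective (b ∷ u) (b ∷ v) eq = cong (b ∷_) (σ-injective u v (∷-injectiveʳ eq))

-- The digits are also listed backwards, starting with k₀.
val : List ℕ → Word
val []       = []
val (d ∷ ds) = replicate d a ++ σ (val ds)

-- The last entry is the leading digit, so this is `NoLeadingZero` of the reversed list.
Canonical : List ℕ → Set
Canonical []           = ⊤
Canonical (d ∷ [])     = NonZero d
Canonical (_ ∷ d ∷ ds) = Canonical (d ∷ ds)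

-- T w is the number of elements. The proofs are irrelevant, so equal digits make equal elements.
Rep : Word → Set
Rep w = [ ds ∈ List ℕ ∣ Canonical ds × val ds ≡ w ]

Rep-≡ : ∀ {w} {r s : Rep w} → value r ≡ value s → r ≡ s
Rep-≡ refl = refl

val≡[]⇒≡[] : ∀ ds → Canonical ds → val ds ≡ [] → ds ≡ []
val≡[]⇒≡[] []                _ _  = refl
val≡[]⇒≡[] (suc d ∷ [])      _ ()
val≡[]⇒≡[] (suc d ∷ e ∷ ds)  _ ()
val≡[]⇒≡[] (zero ∷ e ∷ ds) c eq with val≡[]⇒≡[] (e ∷ ds) c (σ-injective (val (e ∷ ds)) [] eq)
... | ()

canonical-tail : ∀ d ds → Canonical (d ∷ ds) → Canonical ds
canonical-tail d []       _ = tt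
canonical-tail d (e ∷ ds) c = c

canonical-0∷ : ∀ {x v} ds → Canonical ds → val ds ≡ x ∷ v → Canonical (0 ∷ ds)
canonical-0∷ (d ∷ ds) c _ = c

Rep-[] : Rep [] ↔ ⊤
Rep-[] = mk↔ₛ′ (λ _ → tt) (λ _ → [] , [ tt , refl ]) (λ _ → refl) unique
  where
  unique : (r : Rep []) → ([] , [ tt , refl ]) ≡ r
  unique ([] , _) = refl
  unique (d ∷ ds , [ p ]) = ⊥-elim-irr (∷≢[] (val≡[]⇒≡[] (d ∷ ds) (proj₁ p) (proj₂ p)))
    where
    ∷≢[] : d ∷ ds ≢ []
    ∷≢[] ()

[]≢σ∷ : ∀ x {v} → [] ≢ σ (x ∷ v)
[]≢σ∷ a ()
[]≢σ∷ b ()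

a∷≢σa : ∀ {u v} → a ∷ u ≢ σ (a ∷ v)
a∷≢σa ()

¬canonical-0 : ¬ Canonical (0 ∷ [])
¬canonical-0 ()

-- The last letter of the image is b, which forces k₀ = 0; injectivity of `σ` then recovers the word
-- of the remaining digits.
Rep-σa : ∀ {v} → Rep (σ (a ∷ v)) ↔ Rep (a ∷ v)
Rep-σa {v} = mk↔ₛ′ to from (λ _ → refl) from-to
  where
  to : Rep (σ (a ∷ v)) → Rep (a ∷ v)
  to ([] , [ p ])         = ⊥-elim-irr ([]≢σ∷ a (proj₂ p))
  to (zero ∷ ds , [ p ])  =
    ds , [ canonical-tail 0 ds (proj₁ p) , σ-injective (val ds) (a ∷ v) (proj₂ p) ]
  to (suc d ∷ ds , [ p ]) = ⊥-elim-irr (a∷≢σa (proj₂ p))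

  from : Rep (a ∷ v) → Rep (σ (a ∷ v))
  from (ds , [ p ]) = 0 ∷ ds , [ canonical-0∷ ds (proj₁ p) (proj₂ p) , cong σ (proj₂ p) ]

  from-to : ∀ r → from (to r) ≡ r
  from-to ([] , [ p ])         = ⊥-elim-irr ([]≢σ∷ a (proj₂ p))
  from-to (zero ∷ ds , [ p ])  = refl
  from-to (suc d ∷ ds , [ p ]) = ⊥-elim-irr (a∷≢σa (proj₂ p))

inc : List ℕ → List ℕ
inc []       = 1 ∷ []
inc (d ∷ ds) = suc d ∷ ds

-- `dec d ds` undoes `inc` on suc d ∷ ds, without producing the non-canonical 0 ∷ [].
dec : ℕ → List ℕ → List ℕ
dec zero    []       = []
dec (suc d) []       = suc d ∷ []
dec d       (e ∷ ds) = d ∷ e ∷ ds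

inc-dec : ∀ d ds → inc (dec d ds) ≡ suc d ∷ ds
inc-dec zero    []      = refl
inc-dec (suc d) []      = refl
inc-dec zero    (_ ∷ _) = refl
inc-dec (suc d) (_ ∷ _) = refl

canonical-inc : ∀ ds → Canonical ds → Canonical (inc ds)
canonical-inc []           _ = _
canonical-inc (d ∷ [])     _ = _
canonical-inc (d ∷ e ∷ ds) c = c

canonical-dec : ∀ d ds → Canonical (suc d ∷ ds) → Canonical (dec d ds)
canonical-dec zero    []      _ = tt
canonical-dec (suc d) []      _ = _
canonical-dec zero    (_ ∷ _) c = c
canonical-dec (suc d) (_ ∷ _) c = c

val-inc : ∀ ds → val (inc ds) ≡ a ∷ val ds
val-inc []       = refl
val-inc (d ∷ ds) = refl

val-dec : ∀ d ds → val (dec d ds) ≡ val (d ∷ ds)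
val-dec zero    []      = refl
val-dec (suc d) []      = refl
val-dec zero    (_ ∷ _) = refl
val-dec (suc d) (_ ∷ _) = refl

-- σ (b ∷ v) = a ∷ σ v: either k₀ = 0, or lowering k₀ by one removes the last letter.
Rep-σb : ∀ {v} → Rep (σ (b ∷ v)) ↔ (Rep (b ∷ v) ⊎ Rep (σ v))
Rep-σb {v} = mk↔ₛ′ to from to-from from-to
  where
  to : Rep (σ (b ∷ v)) → Rep (b ∷ v) ⊎ Rep (σ v)
  to ([] , [ p ])         = ⊥-elim-irr ([]≢σ∷ b (proj₂ p))
  to (zero ∷ ds , [ p ])  =
    inj₁ (ds , [ canonical-tail 0 ds (proj₁ p) , σ-injective (val ds) (b ∷ v) (proj₂ p) ])
  to (suc d ∷ ds , [ p ]) =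
    inj₂ (dec d ds
         , [ canonical-dec d ds (proj₁ p) , trans (val-dec d ds) (∷-injectiveʳ (proj₂ p)) ])

  from : Rep (b ∷ v) ⊎ Rep (σ v) → Rep (σ (b ∷ v))
  from (inj₁ (ds , [ p ])) = 0 ∷ ds , [ canonical-0∷ ds (proj₁ p) (proj₂ p) , cong σ (proj₂ p) ]
  from (inj₂ (ds , [ p ])) =
    inc ds , [ canonical-inc ds (proj₁ p) , trans (val-inc ds) (cong (a ∷_) (proj₂ p)) ]

  to-from : ∀ r → to (from r) ≡ r
  to-from (inj₁ _)                = refl
  to-from (inj₂ ([] , _))         = refl
  to-from (inj₂ (zero ∷ [] , [ p ])) = ⊥-elim-irr (¬canonical-0 (proj₁ p))
  to-from (inj₂ (suc d ∷ [] , _)) = refl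
  to-from (inj₂ (zero ∷ e ∷ ds , _)) = refl
  to-from (inj₂ (suc d ∷ e ∷ ds , _)) = refl

  from-to : ∀ r → from (to r) ≡ r
  from-to ([] , [ p ])         = ⊥-elim-irr ([]≢σ∷ b (proj₂ p))
  from-to (zero ∷ ds , _)  = refl
  from-to (suc d ∷ ds , _) = Rep-≡ (inc-dec d ds)

-- A letter b arises only within an image ab, so it is always preceded by an a in reading order.
val-≢b : ∀ ds → val ds ≢ b ∷ []
val-≢b (zero ∷ ds) eq with val ds
val-≢b (zero ∷ ds) () | []
val-≢b (zero ∷ ds) () | a ∷ _
val-≢b (zero ∷ ds) () | b ∷ _

val-≢bb : ∀ ds {v} → val ds ≢ b ∷ b ∷ v
val-≢bb (zero ∷ ds) eq with val ds
val-≢bb (zero ∷ ds) () | []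
val-≢bb (zero ∷ ds) () | a ∷ _
val-≢bb (zero ∷ ds) () | b ∷ _

Rep-b : Rep (b ∷ []) ↔ ⊥
Rep-b = mk↔ₛ′ absurd (λ ()) (λ ()) (⊥-elim ∘ absurd)
  where
  absurd : Rep (b ∷ []) → ⊥
  absurd (ds , [ p ]) = ⊥-elim-irr (val-≢b ds (proj₂ p))

Rep-bb : ∀ {v} → Rep (b ∷ b ∷ v) ↔ ⊥
Rep-bb {v} = mk↔ₛ′ absurd (λ ()) (λ ()) (⊥-elim ∘ absurd)
  where
  absurd : Rep (b ∷ b ∷ v) → ⊥
  absurd (ds , [ p ]) = ⊥-elim-irr (val-≢bb ds (proj₂ p))

-- Prefixes of 𝐟 and their desubstitution

-- wx is a prefix of 𝐟, where x is the first or the second letter of the image of a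
-- letter under the substitution.
data Pre : Word → Letter → Set where
  start  : Pre [] a
  first  : ∀ {w x} → Pre w x → Pre (σ w) a
  second : ∀ {w} → Pre w a → Pre (a ∷ σ w) b

-- The equation replaces an index `x ∷ v`, which could not be unified with `σ w`.
Pre-tail : ∀ {w x y v} → Pre w y → w ≡ x ∷ v → Pre v x
Pre-tail (second p)               refl = first p
Pre-tail (first {[]} p)           ()
Pre-tail (first {a ∷ w} p)        refl = second (Pre-tail p refl)
Pre-tail (first {b ∷ w} p)        refl = first (Pre-tail p refl)

Pre-b : ∀ {w} → Pre w b → ∃ λ v → w ≡ a ∷ σ v × Pre v a
Pre-b (second p) = _ , refl , p

-- An a followed by another a is the whole image of a b.
Pre-aa : ∀ {v} → Pre (a ∷ v) a → ∃ λ u → v ≡ σ u × Pre u b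
Pre-aa p = go p refl
  where
  go : ∀ {w v} → Pre w a → w ≡ a ∷ v → ∃ λ u → v ≡ σ u × Pre u b
  go (first {b ∷ u} p) refl = u , refl , Pre-tail p refl

Pre-next : ∀ {w x} → Pre w x → ∃ λ y → Pre (x ∷ w) y
Pre-next start              = b , second start
Pre-next (first {x = a} p)  = b , second p
Pre-next (first {x = b} p)  = a , first (proj₂ (Pre-next p))
Pre-next (second p)         = a , first (proj₂ (Pre-next p))

-- Letter and factor counts under the substitution

#a #b #aa : Word → ℕ
#a []      = 0
#a (a ∷ w) = suc (#a w)
#a (b ∷ w) = #a w
#b []      = 0
#b (a ∷ w) = #b w
#b (b ∷ w) = suc (#b w)
#aa []          = 0
#aa (a ∷ a ∷ w) = suc (#aa (a ∷ w))
#aa (a ∷ w)     = #aa w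
#aa (b ∷ w)     = #aa w

#a-σ : ∀ w → #a (σ w) ≡ length w
#a-σ []      = refl
#a-σ (a ∷ w) = cong suc (#a-σ w)
#a-σ (b ∷ w) = cong suc (#a-σ w)

#b-σ : ∀ w → #b (σ w) ≡ #a w
#b-σ []      = refl
#b-σ (a ∷ w) = cong suc (#b-σ w)
#b-σ (b ∷ w) = #b-σ w

length-# : ∀ w → length w ≡ #a w + #b w
length-# []      = refl
length-# (a ∷ w) = cong suc (length-# w)
length-# (b ∷ w) = trans (cong suc (length-# w)) (sym (+-suc (#a w) (#b w)))

length-≤-σ : ∀ w → length w ≤ length (σ w)
length-≤-σ []      = z≤n
length-≤-σ (a ∷ w) = s≤s (m≤n⇒m≤1+n (length-≤-σ w))
length-≤-σ (b ∷ w) = s≤s (length-≤-σ w)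

-- Every image begins with a, so aa occurs exactly where the image of a b meets the next letter; the
-- added a provides this letter for the last image.
#aa-σ : ∀ w → #aa (a ∷ σ w) ≡ #b w
#aa-σ []      = refl
#aa-σ (a ∷ w) = #aa-σ w
#aa-σ (b ∷ w) = cong suc (#aa-σ w)

-- Each a before the last letter is followed by b or by a. Every b is preceded by an a, so the first
-- case occurs once per b; the second is counted by `#aa`.
#a-∷a : ∀ {w x} → Pre (a ∷ w) x → #a w ≡ #b w + #aa (a ∷ w)
#a-∷b : ∀ {w x} → Pre (b ∷ w) x → #a w ≡ suc (#b w) + #aa w
#a-∷a {[]}    p = refl
#a-∷a {a ∷ w} p = trans (cong suc (#a-∷a (Pre-tail p refl))) (sym (+-suc (#b w) _))
#a-∷a {b ∷ w} p = #a-∷b (Pre-tail p refl)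
#a-∷b p with Pre-b (Pre-tail p refl)
... | _ , refl , _ = cong suc (#a-∷a (Pre-tail p refl))

-- The number of representations of a prefix

count : Word → ℕ
count []      = 1
count (a ∷ w) = suc (#b w)
count (b ∷ w) = suc (#aa w)

⊎-count : ∀ {A B C : Set} {m n} → Fin m ↔ A → Fin n ↔ B → C ↔ (A ⊎ B) → Fin (m + n) ↔ C
⊎-count p q r = ↔-trans +↔⊎ (↔-trans (p ⊎-↔ q) (↔-sym r))

Fin-resp-≡ : ∀ {m n} {A : Set} → m ≡ n → Fin m ↔ A → Fin n ↔ A
Fin-resp-≡ refl p = p

-- Induction on a bound `k` for the length, since the recurrences lead to words that are not
-- subterms of `w`. The last letter of the desubstituted word selects the recurrence.
Rep-count′ : ∀ k {w x} → length w < k → Pre w x → Fin (count w) ↔ Rep w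
Rep-count′ (suc k) _ start = ↔-trans 1↔⊤ (↔-sym Rep-[])
Rep-count′ (suc k) _ (first {[]} p) = ↔-trans 1↔⊤ (↔-sym Rep-[])
Rep-count′ (suc k) l (first {a ∷ v} p) =
  Fin-resp-≡ (cong suc (sym (#aa-σ v)))
    (↔-trans (Rep-count′ k (≤-trans (s≤s (s≤s (length-≤-σ v))) (s≤s⁻¹ l)) p) (↔-sym Rep-σa))
Rep-count′ (suc k) l (first {b ∷ v} p) with Pre-b (Pre-tail p refl)
... | u , refl , q =
  -- As `v` ends in a, `Rep-σa` turns the summand `Rep (σ v)` into `Rep v`, so both summands belong
  -- to shorter prefixes of 𝐟.
  Fin-resp-≡ (cong suc eq)
    (⊎-count (Rep-count′ k l₁ p) (Rep-count′ k (<-trans (n<1+n _) l₁) (Pre-tail p refl))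
      (↔-trans Rep-σb (↔-refl ⊎-↔ Rep-σa)))
  where
  w = a ∷ σ u
  l₁ : suc (length w) < k
  l₁ = ≤-trans (s≤s (s≤s (s≤s (length-≤-σ (σ u))))) (s≤s⁻¹ l)
  eq : #aa w + suc (#b (σ u)) ≡ #b (σ w)
  eq = trans (+-comm (#aa w) _) (trans (sym (#a-∷b p)) (sym (#b-σ w)))
-- From here on the prefix stops inside the image of an a. Its last a is read as the image of a b:
-- `a ∷ σ w` is `σ (b ∷ w)`, although in 𝐟 the letter after `w` is a.
Rep-count′ (suc k) l (second {[]} p) =
  ⊎-count 0↔⊥ (↔-trans 1↔⊤ (↔-sym Rep-[])) (↔-trans Rep-σb (Rep-b ⊎-↔ ↔-refl))
Rep-count′ (suc k) l (second {b ∷ v} p) =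
  ⊎-count 0↔⊥ (Rep-count′ k (s≤s⁻¹ l) (first p)) (↔-trans Rep-σb (Rep-bb ⊎-↔ ↔-refl))
-- Here a ∷ v = a ∷ σ u with u = a ∷ σ z.  The word b ∷ a ∷ v = σ (a ∷ u) is not a prefix of
-- 𝐟, but it has as many representations as a ∷ u = σ (b ∷ b ∷ z), hence as σ (b ∷ z) = u.
Rep-count′ (suc k) l (second {a ∷ v} p) with Pre-aa p
... | u , refl , q with Pre-b q
... | z , refl , r =
  Fin-resp-≡ (cong suc eq)
    (⊎-count Rep-σ[a∷u] (Rep-count′ k (s≤s⁻¹ l) (first p)) Rep-σb)
  where
  l₁ : length u < k
  l₁ = ≤-trans (s≤s (≤-trans (length-≤-σ u) (length-≤-σ (σ u)))) (≤-trans (m≤n+m _ 2) (s≤s⁻¹ l))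
  Rep-σ[a∷u] : Fin (count u) ↔ Rep (σ (a ∷ u))
  Rep-σ[a∷u] = ↔-trans
    (⊎-count 0↔⊥ (Rep-count′ k l₁ q) (↔-trans Rep-σb (Rep-bb ⊎-↔ ↔-refl)))
    (↔-sym Rep-σa)
  eq : #b (σ z) + suc (#aa (a ∷ σ (σ u))) ≡ #b (σ (a ∷ σ u))
  eq = begin
    #b (σ z) + suc (#aa (a ∷ σ (σ u)))
      ≡⟨ cong (λ m → #b (σ z) + suc m) (trans (#aa-σ (σ u)) (#b-σ u)) ⟩
    #b (σ z) + suc (#a u)               ≡⟨ +-comm (#b (σ z)) _ ⟩
    suc (#a u + #b u)                   ≡⟨ cong suc (length-# u) ⟨
    suc (length u)                      ≡⟨ cong suc (trans (#b-σ (σ u)) (#a-σ u)) ⟨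
    #b (σ (a ∷ σ u))                    ∎
    where open ≡-Reasoning

Rep-count : ∀ {w x} → Pre w x → Fin (count w) ↔ Rep w
Rep-count = Rep-count′ _ ≤-refl

-- From reversed words to valid representations

h : Word → Word
h []      = []
h (a ∷ w) = a ∷ b ∷ h w
h (b ∷ w) = a ∷ h w

h-++ : ∀ u v → h (u ++ v) ≡ h u ++ h v
h-++ []      v = refl
h-++ (a ∷ u) v = cong (λ w → a ∷ b ∷ w) (h-++ u v)
h-++ (b ∷ u) v = cong (a ∷_) (h-++ u v)

h-^ʷ : ∀ w k → h (w ^ʷ k) ≡ h w ^ʷ k
h-^ʷ w zero    = refl
h-^ʷ w (suc k) = trans (h-++ w (w ^ʷ k)) (cong (h w ++_) (h-^ʷ w k))

h-f : ∀ m → h (f m) ≡ f (suc m)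
h-f 0             = refl
h-f 1             = refl
h-f (suc (suc m)) = trans (h-++ (f (suc m)) (f m)) (cong₂ _++_ (h-f (suc m)) (h-f m))

h-ʳ++ : ∀ w u → h (w ʳ++ u) ≡ σ w ʳ++ h u
h-ʳ++ []      u = refl
h-ʳ++ (a ∷ w) u = h-ʳ++ w (a ∷ u)
h-ʳ++ (b ∷ w) u = h-ʳ++ w (b ∷ u)

-- Applying `h` to `f m` gives `f (suc m)`. The image of `x` begins with a, and when `x` is a its
-- second letter is b.
Pre⇒f : ∀ {w x} → Pre w x → ∃₂ λ m u → f m ≡ w ʳ++ (x ∷ u)
Pre⇒f start = 0 , [] , refl
Pre⇒f (first {w} {x} p) with Pre⇒f p
... | m , u , eq = suc m , _ , trans (sym (h-f m))
  (trans (cong h eq) (trans (h-ʳ++ w (x ∷ u)) (cong (σ w ʳ++_) (proj₂ (h-∷ x)))))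
  where
  h-∷ : ∀ x → ∃ λ v → h (x ∷ u) ≡ a ∷ v
  h-∷ a = _ , refl
  h-∷ b = _ , refl
Pre⇒f (second {w} p) with Pre⇒f p
... | m , u , eq = suc m , _ , trans (sym (h-f m)) (trans (cong h eq) (h-ʳ++ w (a ∷ u)))

applyUpTo-next : ∀ {A : Set} (g : ℕ → A) n ys {x zs} →
                 applyUpTo g n ≡ ys ++ x ∷ zs → g (length ys) ≡ x
applyUpTo-next g (suc n) []       eq = ∷-injectiveˡ eq
applyUpTo-next g (suc n) (y ∷ ys) eq = applyUpTo-next (g ∘ suc) n ys (∷-injectiveʳ eq)

Pre⇒𝐟 : ∀ {w x} → Pre w x → 𝐟 (suc (length w)) ≡ x
Pre⇒𝐟 {w} {x} p with Pre⇒f p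
... | m , u , eq = subst (λ n → 𝐟 (suc n) ≡ x) (length-reverse w)
  (applyUpTo-next (λ j → 𝐟 (suc j)) (length (f m)) (reverse w)
    (trans (prefix-f m) (trans eq (ʳ++-defn w))))

length-prefix : ∀ n → length (prefix n) ≡ n
length-prefix n = length-applyUpTo _ n

length-reverse-prefix : ∀ n → length (reverse (prefix n)) ≡ n
length-reverse-prefix n = trans (length-reverse (prefix n)) (length-prefix n)

reverse-prefix : ∀ n → reverse (prefix (suc n)) ≡ 𝐟 (suc n) ∷ reverse (prefix n)
reverse-prefix n = trans (cong reverse (sym (applyUpTo-∷ʳ (λ j → 𝐟 (suc j)) n)))
  (reverse-++ (prefix n) _)

-- `Pre-next` yields some next letter, and `Pre⇒𝐟` identifies it as the letter of 𝐟.
Pre-prefix : ∀ n → Pre (reverse (prefix n)) (𝐟 (suc n))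
Pre-prefix zero    = start
Pre-prefix (suc n) with Pre-next (Pre-prefix n)
... | y , p = subst₂ Pre (sym (reverse-prefix n))
  (trans (sym (Pre⇒𝐟 p)) (cong (λ k → 𝐟 (suc (suc k))) (length-reverse-prefix n))) p

replicate-ʳ++ : ∀ {A : Set} k {x : A} {ys} → replicate k x ʳ++ ys ≡ replicate k x ++ ys
replicate-ʳ++ zero    = refl
replicate-ʳ++ (suc k) {x} {ys} = trans (replicate-ʳ++ k) (lem k)
  where
  lem : ∀ k → replicate k x ++ x ∷ ys ≡ x ∷ replicate k x ++ ys
  lem zero    = refl
  lem (suc k) = cong (x ∷_) (lem k)

-- A new last digit raises the index of every other digit by one, which is the effect of `h` by
-- `h-f`; the digit itself counts copies of `f 0`.
word-∷ʳ : ∀ ks k → word (ks ∷ʳ k) ≡ h (word ks) ++ replicate k a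
word-∷ʳ []       k = trans (++-identityʳ _) (go k)
  where
  go : ∀ k → f 0 ^ʷ k ≡ replicate k a
  go zero    = refl
  go (suc k) = cong (a ∷_) (go k)
word-∷ʳ (j ∷ ks) k = begin
  (f (length (ks ∷ʳ k)) ^ʷ j) ++ word (ks ∷ʳ k)
    ≡⟨ cong₂ _++_ (cong (_^ʷ j) f-length-∷ʳ) (word-∷ʳ ks k) ⟩
  (h (f (length ks)) ^ʷ j) ++ h (word ks) ++ replicate k a
    ≡⟨ ++-assoc (h (f (length ks)) ^ʷ j) _ _ ⟨
  ((h (f (length ks)) ^ʷ j) ++ h (word ks)) ++ replicate k a
    ≡⟨ cong (_++ replicate k a) (cong (_++ h (word ks)) (h-^ʷ (f (length ks)) j)) ⟨
  (h (f (length ks) ^ʷ j) ++ h (word ks)) ++ replicate k a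
    ≡⟨ cong (_++ replicate k a) (h-++ (f (length ks) ^ʷ j) (word ks)) ⟨
  h ((f (length ks) ^ʷ j) ++ word ks) ++ replicate k a ∎
  where
  open ≡-Reasoning
  f-length-∷ʳ : f (length (ks ∷ʳ k)) ≡ h (f (length ks))
  f-length-∷ʳ = trans (cong f (trans (length-++ ks) (+-comm (length ks) 1))) (sym (h-f (length ks)))

reverse-val : ∀ ds → reverse (val ds) ≡ word (reverse ds)
reverse-val []       = refl
reverse-val (d ∷ ds) = begin
  reverse (replicate d a ++ σ (val ds))
    ≡⟨ reverse-++ (replicate d a) (σ (val ds)) ⟩
  reverse (σ (val ds)) ++ reverse (replicate d a)
    ≡⟨ cong₂ _++_ (sym (h-ʳ++ (val ds) [])) (trans (replicate-ʳ++ d) (++-identityʳ _)) ⟩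
  h (reverse (val ds)) ++ replicate d a
    ≡⟨ cong (λ w → h w ++ replicate d a) (reverse-val ds) ⟩
  h (word (reverse ds)) ++ replicate d a
    ≡⟨ word-∷ʳ (reverse ds) d ⟨
  word (reverse ds ∷ʳ d)
    ≡⟨ cong word (unfold-reverse d ds) ⟨
  word (reverse (d ∷ ds)) ∎
  where open ≡-Reasoning

length-f : ∀ m → length (f m) ≡ F (m + 2)
length-f 0             = refl
length-f 1             = refl
length-f (suc (suc m)) = trans (length-++ (f (suc m))) (cong₂ _+_ (length-f (suc m)) (length-f m))

length-^ʷ : ∀ w k → length (w ^ʷ k) ≡ k * length w
length-^ʷ w zero    = refl
length-^ʷ w (suc k) = trans (length-++ w) (cong (_+_ (length w)) (length-^ʷ w k))

-- Hence the numerical half of `Valid` follows from the equality of words.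
length-word : ∀ ks → length (word ks) ≡ [ ks ]F
length-word []       = refl
length-word (k ∷ ks) = trans (length-++ (f (length ks) ^ʷ k))
  (cong₂ _+_ (trans (length-^ʷ (f (length ks)) k) (cong (k *_) (length-f (length ks))))
             (length-word ks))

NoLeadingZero-∷ʳ : ∀ ks j k → NoLeadingZero ((ks ∷ʳ j) ∷ʳ k) ≡ NoLeadingZero (ks ∷ʳ j)
NoLeadingZero-∷ʳ []      j k = refl
NoLeadingZero-∷ʳ (_ ∷ _) j k = refl

NoLeadingZero-reverse : ∀ ds → NoLeadingZero (reverse ds) ≡ Canonical ds
NoLeadingZero-reverse []           = refl
NoLeadingZero-reverse (d ∷ [])     = refl
NoLeadingZero-reverse (d ∷ e ∷ ds) = begin
  NoLeadingZero (reverse (d ∷ e ∷ ds))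
    ≡⟨ cong NoLeadingZero
         (trans (unfold-reverse d (e ∷ ds)) (cong (_∷ʳ d) (unfold-reverse e ds))) ⟩
  NoLeadingZero ((reverse ds ∷ʳ e) ∷ʳ d)
    ≡⟨ NoLeadingZero-∷ʳ (reverse ds) e d ⟩
  NoLeadingZero (reverse ds ∷ʳ e)
    ≡⟨ cong NoLeadingZero (unfold-reverse e ds) ⟨
  NoLeadingZero (reverse (e ∷ ds))
    ≡⟨ NoLeadingZero-reverse (e ∷ ds) ⟩
  Canonical (e ∷ ds) ∎
  where open ≡-Reasoning

Rep↔ValidRep : ∀ n → Rep (reverse (prefix n)) ↔ ValidRep n
Rep↔ValidRep n = mk↔ₛ′ to from
  (λ r → ValidRep-≡ (reverse-involutive (value r))) (λ r → Rep-≡ (reverse-involutive (value r)))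
  where
  ValidRep-≡ : {r s : ValidRep n} → value r ≡ value s → r ≡ s
  ValidRep-≡ refl = refl

  valid : ∀ ds → Canonical ds × val ds ≡ reverse (prefix n) →
          NoLeadingZero (reverse ds) × Valid n (reverse ds)
  valid ds (c , eq) = subst (λ A → A) (sym (NoLeadingZero-reverse ds)) c
    , trans (sym (length-prefix n)) (trans (cong length eq′) (length-word (reverse ds))) , eq′
    where
    eq′ : prefix n ≡ word (reverse ds)
    eq′ = trans (sym (reverse-involutive (prefix n)))
      (trans (cong reverse (sym eq)) (reverse-val ds))

  canonical : ∀ ks → NoLeadingZero ks × Valid n ks →
              Canonical (reverse ks) × val (reverse ks) ≡ reverse (prefix n)
  canonical ks (z , _ , eq) =
    subst (λ A → A) (NoLeadingZero-reverse (reverse ks))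
      (subst NoLeadingZero (sym (reverse-involutive ks)) z)
    , trans (sym (reverse-involutive _)) (cong reverse
        (trans (reverse-val (reverse ks)) (trans (cong word (reverse-involutive ks)) (sym eq))))

  to : Rep (reverse (prefix n)) → ValidRep n
  to (ds , [ p ]) = reverse ds , [ valid ds p ]

  from : ValidRep n → Rep (reverse (prefix n))
  from (ks , [ p ]) = reverse ks , [ canonical ks p ]

V-count : ∀ n → V n ≡ count (reverse (prefix n))
V-count n = ↔⇒≡ (↔-trans (proj₂ (validRep-finite n))
  (↔-sym (↔-trans (Rep-count (Pre-prefix n)) (Rep↔ValidRep n))))

-- Occurrences in a word and in its reversal

occurrences-b : ∀ w → occurrences (b ∷ []) w ≡ #b w
occurrences-b []      = refl
occurrences-b (a ∷ w) = occurrences-b w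
occurrences-b (b ∷ w) = cong suc (occurrences-b w)

occurrences-aa : ∀ w → occurrences (a ∷ a ∷ []) w ≡ #aa w
occurrences-aa []          = refl
occurrences-aa (a ∷ [])    = refl
occurrences-aa (a ∷ a ∷ w) = cong suc (occurrences-aa (a ∷ w))
occurrences-aa (a ∷ b ∷ w) = occurrences-aa (b ∷ w)
occurrences-aa (b ∷ w)     = occurrences-aa w

#b-ʳ++ : ∀ w u → #b (w ʳ++ u) ≡ #b w + #b u
#b-ʳ++ []      u = refl
#b-ʳ++ (a ∷ w) u = #b-ʳ++ w (a ∷ u)
#b-ʳ++ (b ∷ w) u = trans (#b-ʳ++ w (b ∷ u)) (+-suc (#b w) (#b u))

-- The letter `x` at the seam is kept on both sides, so no factor is lost or counted twice there.
#aa-ʳ++ : ∀ w x u → #aa (w ʳ++ (x ∷ u)) ≡ #aa (x ∷ w) + #aa (x ∷ u)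
#aa-ʳ++ []      a u = refl
#aa-ʳ++ []      b u = refl
#aa-ʳ++ (a ∷ w) a u = trans (#aa-ʳ++ w a (a ∷ u)) (+-suc (#aa (a ∷ w)) (#aa (a ∷ u)))
#aa-ʳ++ (a ∷ w) b u = #aa-ʳ++ w a (b ∷ u)
#aa-ʳ++ (b ∷ w) a u = #aa-ʳ++ w b (a ∷ u)
#aa-ʳ++ (b ∷ w) b u = #aa-ʳ++ w b (b ∷ u)

#aa-reverse : ∀ w → #aa (reverse w) ≡ #aa w
#aa-reverse []      = refl
#aa-reverse (x ∷ w) = trans (#aa-ʳ++ w x [])
  (trans (cong (_+_ (#aa (x ∷ w))) (#aa-[-] x)) (+-identityʳ _))
  where
  #aa-[-] : ∀ x → #aa (x ∷ []) ≡ 0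
  #aa-[-] a = refl
  #aa-[-] b = refl

V-∷ : ∀ n {x} → 𝐟 (suc n) ≡ x → V (suc n) ≡ count (x ∷ reverse (prefix n))
V-∷ n refl = trans (V-count (suc n)) (cong count (reverse-prefix n))

-- Comparisons with φ, and the bounds on A - Bφ

infix 4 _<φ·_ _>φ·_

-- x < φ y and x > φ y, in view of φ² = φ + 1
_<φ·_ _>φ·_ : ℕ → ℕ → Set
x <φ· y = x * x < x * y + y * y
x >φ· y = x * y + y * y < x * x

-- Transfers l ≤ r to x ≤ y when y − x = s + (r − l).
cancel-≤ : ∀ x s y {l r} → x + s + r ≡ y + l → l ≤ r → x ≤ y
cancel-≤ x s y {l} {r} eq l≤r = +-cancelʳ-≤ r x y (begin
  x + r      ≤⟨ +-monoˡ-≤ r (m≤m+n x s) ⟩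
  x + s + r  ≡⟨ eq ⟩
  y + l      ≤⟨ +-monoʳ-≤ y l≤r ⟩
  y + r      ∎)
  where open ≤-Reasoning

-- The difference (x + y) - φx is -(x - φy)/φ, so one substitution step reverses the sign.
<φ·⇒>φ· : ∀ {x y} → x <φ· y → x + y >φ· x
<φ·⇒>φ· {x} {y} p = cancel-≤ _ 0 _ (eq x y) p
  where
  eq : ∀ x y → suc ((x + y) * x + x * x) + 0 + (x * y + y * y) ≡ (x + y) * (x + y) + suc (x * x)
  eq = solve-∀

>φ·⇒<φ· : ∀ {x y} → x >φ· y → x + y <φ· x
>φ·⇒<φ· {x} {y} p = cancel-≤ _ 0 _ (eq x y) p
  where
  eq : ∀ x y → suc ((x + y) * (x + y)) + 0 + x * x ≡ ((x + y) * x + x * x) + suc (x * y + y * y)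
  eq = solve-∀

>φ·⇒> : ∀ {x y} → x >φ· y → y < x
>φ·⇒> {x} {y} p = ≰⇒> λ x≤y → <⇒≱ p (≤-trans (*-mono-≤ x≤y x≤y) (m≤n+m _ _))

>φ·-pred : ∀ {x y} → x >φ· suc y → x >φ· y
>φ·-pred {x} {y} = ≤-<-trans (+-mono-≤ (*-monoʳ-≤ x (n≤1+n y)) (*-mono-≤ (n≤1+n y) (n≤1+n y)))

-- From `x` to `suc x` the quantity x² - xy grows by 2x + 1 - y. If this is not positive, then
-- `x < y`, which suffices.
<φ·-pred : ∀ {x y} → suc x <φ· y → x <φ· y
<φ·-pred {x} {y} p with ≤-total y (suc (x + x))
... | inj₁ y≤1+2x = cancel-≤ _ 0 _ (eq x y) (+-mono-≤ y≤1+2x p)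
  where
  eq : ∀ x y → suc (x * x) + 0 + (suc (x + x) + (suc x * y + y * y))
             ≡ (x * y + y * y) + (y + suc (suc x * suc x))
  eq = solve-∀
... | inj₂ 1+2x≤y = <-≤-trans (*-mono-< x<y x<y) (m≤n+m _ _)
  where
  x<y : x < y
  x<y = ≤-trans (s≤s (m≤m+n x x)) 1+2x≤y

-- A − Bφ lies in (−1, φ − 1) before a letter a, in (φ − 1, φ) before a letter b
Bounds : Letter → ℕ → ℕ → Set
Bounds a A B = suc A >φ· B     × suc A <φ· suc B
Bounds b A B = suc A >φ· suc B × A <φ· suc B

Bounds⇒> : ∀ x {A B} → Bounds x A B → suc A >φ· B
Bounds⇒> a (p , _) = p
Bounds⇒> b {A} (p , _) = >φ·-pred {suc A} p

Bounds⇒< : ∀ x {A B} → Bounds x A B → A <φ· suc B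
Bounds⇒< a {A} {B} (_ , q) = <φ·-pred {A} {suc B} q
Bounds⇒< b (_ , q) = q

-- Multiplication by -1/φ maps (-1, φ) onto (-1, φ - 1), the case `first`. For `second` it is
-- applied to (-1, φ - 1), and the extra a adds 1, which gives (φ - 1, φ).
Pre-bounds : ∀ {w x} → Pre w x → Bounds x (#a w) (#b w)
Pre-bounds start = s≤s z≤n , s≤s (s≤s z≤n)
Pre-bounds (first {w} {x} p) rewrite #a-σ w | #b-σ w | length-# w =
  subst (_>φ· #a w) (+-suc (#a w) (#b w)) (<φ·⇒>φ· {#a w} (Bounds⇒< x (Pre-bounds p)))
  , >φ·⇒<φ· {suc (#a w)} (Bounds⇒> x (Pre-bounds p))
Pre-bounds (second {w} p) rewrite #a-σ w | #b-σ w | length-# w with Pre-bounds p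
... | l , u = subst (_>φ· suc (#a w)) (+-suc (suc (#a w)) (#b w)) (<φ·⇒>φ· {suc (#a w)} u)
  , >φ·⇒<φ· {suc (#a w)} l

-- Signs in ℚ(√5), reduced to inequalities between natural numbers

coprime-1 : ∀ i → Coprime ℤ.∣ i ∣ 1
coprime-1 i = coprime-sym (1-coprimeTo ℤ.∣ i ∣)

ι : ℤ → ℚ
ι i = i ℚ./ 1

ι-mkℚ : ∀ i → ι i ≡ mkℚ i 0 (coprime-1 i)
ι-mkℚ i = ℚ.↥p/↧p≡p (mkℚ i 0 (coprime-1 i))

ι-+ : ∀ i j → ι (i ℤ.+ j) ≡ ι i ℚ.+ ι j
ι-+ i j = sym (trans (cong₂ ℚ._+_ (ι-mkℚ i) (ι-mkℚ j))
  (cong (ℚ._/ 1) (cong₂ ℤ._+_ (ℤ.*-identityʳ i) (ℤ.*-identityʳ j))))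

ι-* : ∀ i j → ι (i ℤ.* j) ≡ ι i ℚ.* ι j
ι-* i j = sym (cong₂ ℚ._*_ (ι-mkℚ i) (ι-mkℚ j))

ι-mono-≤ : ∀ {i j} → i ℤ.≤ j → ι i ℚ.≤ ι j
ι-mono-≤ {i} {j} p = subst₂ ℚ._≤_ (sym (ι-mkℚ i)) (sym (ι-mkℚ j))
  (ℚ.*≤* (subst₂ ℤ._≤_ (sym (ℤ.*-identityʳ i)) (sym (ℤ.*-identityʳ j)) p))

ι-cancel-≤ : ∀ {i j} → ι i ℚ.≤ ι j → i ℤ.≤ j
ι-cancel-≤ {i} {j} p = subst₂ ℤ._≤_ (ℤ.*-identityʳ i) (ℤ.*-identityʳ j)
  (ℚ.drop-*≤* (subst₂ ℚ._≤_ (ι-mkℚ i) (ι-mkℚ j) p))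

κ : ℕ → ℚ
κ n = ι (+ n)

κ-* : ∀ m n → κ (m * n) ≡ κ m ℚ.* κ n
κ-* m n = trans (cong ι (ℤ.pos-* m n)) (ι-* (+ m) (+ n))

κ-mono-≤ : ∀ {m n} → m ≤ n → κ m ℚ.≤ κ n
κ-mono-≤ p = ι-mono-≤ (ℤ.+≤+ p)

κ-cancel-≤ : ∀ {m n} → κ m ℚ.≤ κ n → m ≤ n
κ-cancel-≤ {m} {n} p with ι-cancel-≤ {+ m} {+ n} p
... | ℤ.+≤+ q = q

square-mono : ∀ {p q} → 0ℚ ℚ.≤ p → p ℚ.≤ q → p ℚ.* p ℚ.≤ q ℚ.* q
square-mono {p} {q} 0≤p p≤q = ℚ.≤-trans
  (ℚ.*-monoˡ-≤-nonNeg p {{ℚ.nonNegative 0≤p}} p≤q)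
  (ℚ.*-monoʳ-≤-nonNeg q {{ℚ.nonNegative (ℚ.≤-trans 0≤p p≤q)}} p≤q)

neg-involutive : ∀ p → ℚ.- (ℚ.- p) ≡ p
neg-involutive = solve 1 (λ x → :- (:- x) := x) refl
  where open +-*-Solver

square-neg : ∀ p → (ℚ.- p) ℚ.* (ℚ.- p) ≡ p ℚ.* p
square-neg = solve 1 (λ x → :- x :* :- x := x :* x) refl
  where open +-*-Solver

5ℚ : ℚ
5ℚ = + 5 ℚ./ 1

-- The common factor `c` is `½` for φ² and `1ℚ` for φ³.
module _ (c : ℚ) .{{_ : ℚ.Positive c}} where

  private instance
    c²>0 : ℚ.Positive (c ℚ.* c)
    c²>0 = ℚ.pos*pos⇒pos c c
    c≥0 : ℚ.NonNegative c
    c≥0 = ℚ.pos⇒nonNeg c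
    c²≥0 : ℚ.NonNegative (c ℚ.* c)
    c²≥0 = ℚ.pos⇒nonNeg (c ℚ.* c)

  [κ*c]² : ∀ m → (κ m ℚ.* c) ℚ.* (κ m ℚ.* c) ≡ κ (m * m) ℚ.* (c ℚ.* c)
  [κ*c]² m = trans (solve 2 (λ x y → (x :* y) :* (x :* y) := (x :* x) :* (y :* y)) refl (κ m) c)
    (cong (ℚ._* (c ℚ.* c)) (sym (κ-* m m)))
    where open +-*-Solver

  5[κ*c]² : ∀ n → 5ℚ ℚ.* ((κ n ℚ.* c) ℚ.* (κ n ℚ.* c)) ≡ κ (5 * (n * n)) ℚ.* (c ℚ.* c)
  5[κ*c]² n = trans (cong (5ℚ ℚ.*_) ([κ*c]² n)) (trans (sym (ℚ.*-assoc 5ℚ (κ (n * n)) (c ℚ.* c)))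
    (cong (ℚ._* (c ℚ.* c)) (sym (κ-* 5 (n * n)))))

  κ*c≥0 : ∀ n → 0ℚ ℚ.≤ κ n ℚ.* c
  κ*c≥0 n = subst (ℚ._≤ κ n ℚ.* c) (ℚ.*-zeroˡ c) (ℚ.*-monoʳ-≤-nonNeg c (κ-mono-≤ {0} {n} z≤n))

  κ*c≤0 : ∀ n → κ n ℚ.* c ℚ.≤ 0ℚ → n ≡ 0
  κ*c≤0 n p = n≤0⇒n≡0 (κ-cancel-≤
    (ℚ.*-cancelʳ-≤-pos c (subst (κ n ℚ.* c ℚ.≤_) (sym (ℚ.*-zeroˡ c)) p)))

  -m+n√5≥0 : ∀ m n → m * m ≤ 5 * (n * n) → NonNegative (ℚ.- (κ m ℚ.* c) +√5· κ n ℚ.* c)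
  -m+n√5≥0 m n p = rat≤0 (ℚ.neg-antimono-≤ (κ*c≥0 m)) (κ*c≥0 n)
    (subst₂ ℚ._≤_ (trans (sym ([κ*c]² m)) (sym (square-neg (κ m ℚ.* c)))) (sym (5[κ*c]² n))
      (ℚ.*-monoʳ-≤-nonNeg (c ℚ.* c) (κ-mono-≤ p)))

  m-n√5≥0 : ∀ m n → 5 * (n * n) ≤ m * m → NonNegative (κ m ℚ.* c +√5· ℚ.- (κ n ℚ.* c))
  m-n√5≥0 m n p = irr≤0 (κ*c≥0 m) (ℚ.neg-antimono-≤ (κ*c≥0 n))
    (subst₂ ℚ._≤_ (trans (sym (5[κ*c]² n)) (cong (5ℚ ℚ.*_) (sym (square-neg (κ n ℚ.* c)))))
      (sym ([κ*c]² m))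
      (ℚ.*-monoʳ-≤-nonNeg (c ℚ.* c) (κ-mono-≤ p)))

  -- The rational part is only bounded above, so that every integer below the claimed ceiling is
  -- covered at once. A constructor with `0ℚ ℚ.≤ p` forces `m` to be 0.
  -m+n√5≥0⁻ : ∀ m n {p} → p ℚ.≤ ℚ.- (κ m ℚ.* c) → NonNegative (p +√5· κ n ℚ.* c) →
              m * m ≤ 5 * (n * n)
  -m+n√5≥0⁻ m n {p} p≤-m = λ where
      (both≥0 0≤p _)     → m²≤ (m≡0 0≤p)
      (irr≤0 0≤p _ _)    → m²≤ (m≡0 0≤p)
      (rat≤0 _ _ p²≤5n²) → κ-cancel-≤ (ℚ.*-cancelʳ-≤-pos (c ℚ.* c)
        (subst₂ ℚ._≤_ ([κ*c]² m) (5[κ*c]² n)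
        (ℚ.≤-trans (square-mono (κ*c≥0 m) m≤-p) (subst (ℚ._≤ _) (sym (square-neg p)) p²≤5n²))))
    where
    m≤-p : κ m ℚ.* c ℚ.≤ ℚ.- p
    m≤-p = subst (ℚ._≤ ℚ.- p) (neg-involutive (κ m ℚ.* c)) (ℚ.neg-antimono-≤ p≤-m)
    m≡0 : 0ℚ ℚ.≤ p → m ≡ 0
    m≡0 0≤p = κ*c≤0 m (ℚ.≤-trans m≤-p (ℚ.neg-antimono-≤ 0≤p))
    m²≤ : m ≡ 0 → m * m ≤ 5 * (n * n)
    m²≤ refl = z≤n

  m-n√5≥0⁻ : ∀ m n {p} → p ℚ.≤ κ m ℚ.* c → NonNegative (p +√5· ℚ.- (κ n ℚ.* c)) →
             5 * (n * n) ≤ m * m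
  m-n√5≥0⁻ m n {p} p≤m = λ where
      (both≥0 _ 0≤-n)      → 5n²≤ (n≡0 0≤-n)
      (rat≤0 _ 0≤-n _)     → 5n²≤ (n≡0 0≤-n)
      (irr≤0 0≤p _ 5n²≤p²) → κ-cancel-≤ (ℚ.*-cancelʳ-≤-pos (c ℚ.* c)
        (subst₂ ℚ._≤_ (5[κ*c]² n) ([κ*c]² m)
        (ℚ.≤-trans (subst (λ q → 5ℚ ℚ.* q ℚ.≤ _) (square-neg (κ n ℚ.* c)) 5n²≤p²)
          (square-mono 0≤p p≤m))))
    where
    n≡0 : 0ℚ ℚ.≤ ℚ.- (κ n ℚ.* c) → n ≡ 0
    n≡0 0≤-n = κ*c≤0 n (subst (ℚ._≤ 0ℚ) (neg-involutive (κ n ℚ.* c)) (ℚ.neg-antimono-≤ 0≤-n))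
    5n²≤ : n ≡ 0 → 5 * (n * n) ≤ m * m
    5n²≤ refl = z≤n

-- The two ceilings

n÷φ² : ∀ n → fromℕ n ÷ φ ^ 2 ≡ κ n ℚ.* (+ 3 ℚ./ 2) +√5· κ n ℚ.* (-[1+ 0 ] ℚ./ 2)
n÷φ² n = cong₂ _+√5·_ (ℚ.+-identityʳ _) (ℚ.+-identityʳ _)

-- The coefficients are those of 1/φ³ = √5 - 2, as those above are of 1/φ² = (3 - √5)/2.
n÷φ³ : ∀ n → fromℕ n ÷ φ ^ 3 ≡ κ n ℚ.* (-[1+ 1 ] ℚ./ 1) +√5· κ n ℚ.* 1ℚ
n÷φ³ n = cong₂ _+√5·_ (ℚ.+-identityʳ _) (ℚ.+-identityʳ _)

κ-half : ∀ n j m → 3 * n ≡ 2 * j + m → κ j ℚ.- κ n ℚ.* (+ 3 ℚ./ 2) ≡ ℚ.- (κ m ℚ.* ½)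
κ-half n j m eq = begin
  κ j ℚ.- κ n ℚ.* (+ 3 ℚ./ 2)
    ≡⟨ solve 2 (λ x y → x :- y :* con (+ 3 ℚ./ 2) := x :- con (κ 3) :* y :* con ½)
         refl (κ j) (κ n) ⟩
  κ j ℚ.- κ 3 ℚ.* κ n ℚ.* ½
    ≡⟨ cong (λ x → κ j ℚ.- x ℚ.* ½) 3n ⟩
  κ j ℚ.- (κ 2 ℚ.* κ j ℚ.+ κ m) ℚ.* ½
    ≡⟨ solve 2 (λ x y → x :- (con (κ 2) :* x :+ y) :* con ½ := :- (y :* con ½)) refl (κ j) (κ m) ⟩
  ℚ.- (κ m ℚ.* ½) ∎
  where
  open ≡-Reasoning
  open +-*-Solver
  3n : κ 3 ℚ.* κ n ≡ κ 2 ℚ.* κ j ℚ.+ κ m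
  3n = begin
    κ 3 ℚ.* κ n            ≡⟨ κ-* 3 n ⟨
    κ (3 * n)              ≡⟨ cong κ eq ⟩
    κ (2 * j + m)          ≡⟨ ι-+ (+ (2 * j)) (+ m) ⟩
    κ (2 * j) ℚ.+ κ m      ≡⟨ cong (ℚ._+ κ m) (κ-* 2 j) ⟩
    κ 2 ℚ.* κ j ℚ.+ κ m    ∎

κ-double : ∀ n j m → m ≡ j + 2 * n → κ j ℚ.- κ n ℚ.* (-[1+ 1 ] ℚ./ 1) ≡ κ m ℚ.* 1ℚ
κ-double n j m refl = begin
  κ j ℚ.- κ n ℚ.* (-[1+ 1 ] ℚ./ 1)
    ≡⟨ solve 2 (λ x y → x :- y :* con (-[1+ 1 ] ℚ./ 1) := (x :+ con (κ 2) :* y) :* con 1ℚ)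
         refl (κ j) (κ n) ⟩
  (κ j ℚ.+ κ 2 ℚ.* κ n) ℚ.* 1ℚ  ≡⟨ cong (λ x → (κ j ℚ.+ x) ℚ.* 1ℚ) (κ-* 2 n) ⟨
  (κ j ℚ.+ κ (2 * n)) ℚ.* 1ℚ    ≡⟨ cong (ℚ._* 1ℚ) (ι-+ (+ j) (+ (2 * n))) ⟨
  κ (j + 2 * n) ℚ.* 1ℚ          ∎
  where
  open ≡-Reasoning
  open +-*-Solver

≰⇒1+n≤ : ∀ {n j} → ¬ (j ℤ.≤ + n) → + suc n ℤ.≤ j
≰⇒1+n≤ p = ℤ.i<j⇒suc[i]≤j (ℤ.≰⇒> p)

-- Put δ = A + 1 - Bφ, which lies in (0, φ). Then n = Bφ² + δ, so n/φ² = B + δ/φ² with δ/φ² in (0,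
-- 1).
⌈n÷φ²⌉ : ∀ A B → suc A >φ· B → suc A <φ· suc B →
         IsCeiling (fromℕ (suc A + B) ÷ φ ^ 2) (+ suc B)
⌈n÷φ²⌉ A B l u = subst (λ x → IsCeiling x (+ suc B)) (sym (n÷φ² n)) (upper , lower)
  where
  n = suc A + B
  -- These are 3n - 2j for j = B + 1 and j = B, so that j - n/φ² = (n√5 - m)/2.
  m⁺ = 3 * A + B + 1
  m⁻ = 3 * suc A + B
  x = κ n ℚ.* (+ 3 ℚ./ 2) +√5· κ n ℚ.* (-[1+ 0 ] ℚ./ 2)
  irr : 0ℚ ℚ.- κ n ℚ.* (-[1+ 0 ] ℚ./ 2) ≡ κ n ℚ.* ½
  irr = solve 1 (λ x → con 0ℚ :- x :* con (-[1+ 0 ] ℚ./ 2) := x :* con ½) refl (κ n)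
    where open +-*-Solver
  eq₁ : ∀ A B → 3 * (suc A + B) ≡ 2 * suc B + (3 * A + B + 1)
  eq₁ = solve-∀
  eq₂ : ∀ A B → (3 * A + B + 1) * (3 * A + B + 1) + (4 * A + 4)
                + (4 * (suc A * suc B + suc B * suc B) + 4 * A)
              ≡ 5 * ((suc A + B) * (suc A + B)) + (4 * suc (suc A * suc A) + 4 * B)
  eq₂ = solve-∀
  eq₃ : ∀ A B → 3 * (suc A + B) ≡ 2 * B + (3 * suc A + B)
  eq₃ = solve-∀
  eq₄ : ∀ A B → 4 * (suc A * suc A) + 0 + 5 * ((suc A + B) * (suc A + B))
              ≡ 4 * (suc A * B + B * B) + (3 * suc A + B) * (3 * suc A + B)
  eq₄ = solve-∀
  upper : x ≤√5 fromℤ (+ suc B)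
  upper = subst₂ (λ p q → NonNegative (p +√5· q)) (sym (κ-half n (suc B) m⁺ (eq₁ A B))) (sym irr)
    -- The difference 5n² - m⁺² is 4A + 4 plus four times the gaps in `u` and in `B ≤ A`.
    (-m+n√5≥0 ½ m⁺ n (cancel-≤ _ (4 * A + 4) _ (eq₂ A B)
      (+-mono-≤ (*-monoʳ-≤ 4 u) (*-monoʳ-≤ 4 (s≤s⁻¹ (>φ·⇒> {suc A} {B} l))))))
  lower : ∀ j → x ≤√5 fromℤ j → + suc B ℤ.≤ j
  -- If j ≤ B, then m⁻² ≤ 5n², which amounts to A + 1 ≤ φB and contradicts `l`.
  lower j x≤j = ≰⇒1+n≤ λ j≤B → <⇒≱ l (*-cancelˡ-≤ 4 (cancel-≤ _ 0 _ (eq₄ A B)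
    (-m+n√5≥0⁻ ½ m⁻ n
      (subst (ι j ℚ.- κ n ℚ.* (+ 3 ℚ./ 2) ℚ.≤_) (κ-half n B m⁻ (eq₃ A B))
        (ℚ.+-monoˡ-≤ _ (ι-mono-≤ j≤B)))
      (subst (λ q → NonNegative (ι j ℚ.- κ n ℚ.* (+ 3 ℚ./ 2) +√5· q)) irr x≤j))))

-- There are E + B letters a. Put ε = φB - (E + B), which lies in (0, 1). Then n = φ²B - ε and E =
-- B/φ - ε, so n/φ³ = E + ε(1 - 1/φ³).
⌈n÷φ³⌉ : ∀ E B → suc (E + B) >φ· B → E + B <φ· B →
         IsCeiling (fromℕ (E + B + B) ÷ φ ^ 3) (+ suc E)
⌈n÷φ³⌉ E B l u = subst (λ x → IsCeiling x (+ suc E)) (sym (n÷φ³ n)) (upper , lower)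
  where
  n = E + B + B
  -- These are j + 2n for j = E + 1 and j = E, so that j - n/φ³ = m - n√5.
  m⁺ = 3 * E + 4 * B + 1
  m⁻ = 3 * E + 4 * B
  x = κ n ℚ.* (-[1+ 1 ] ℚ./ 1) +√5· κ n ℚ.* 1ℚ
  irr : 0ℚ ℚ.- κ n ℚ.* 1ℚ ≡ ℚ.- (κ n ℚ.* 1ℚ)
  irr = ℚ.+-identityˡ _
  E≤B : E ≤ B
  E≤B = ≮⇒≥ λ B<E → <⇒≱ u (cancel-≤ _ (E * E) _ (eq₅ E B) (*-monoʳ-≤ B (<⇒≤ B<E)))
    where
    eq₅ : ∀ E B → (E + B) * B + B * B + E * E + B * E ≡ (E + B) * (E + B) + B * B
    eq₅ = solve-∀
  eq₁ : ∀ E B → 3 * E + 4 * B + 1 ≡ suc E + 2 * (E + B + B)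
  eq₁ = solve-∀
  eq₂ : ∀ E B → 5 * ((E + B + B) * (E + B + B)) + (2 * B + 1)
                + (4 * (suc (E + B) * suc (E + B)) + 2 * B)
              ≡ (3 * E + 4 * B + 1) * (3 * E + 4 * B + 1)
                + (4 * suc (suc (E + B) * B + B * B) + 2 * E)
  eq₂ = solve-∀
  eq₃ : ∀ E B → 3 * E + 4 * B ≡ E + 2 * (E + B + B)
  eq₃ = solve-∀
  eq₄ : ∀ E B → 4 * ((E + B) * B + B * B) + 0 + (3 * E + 4 * B) * (3 * E + 4 * B)
              ≡ 4 * ((E + B) * (E + B)) + 5 * ((E + B + B) * (E + B + B))
  eq₄ = solve-∀
  upper : x ≤√5 fromℤ (+ suc E)
  upper = subst₂ (λ p q → NonNegative (p +√5· q)) (sym (κ-double n (suc E) m⁺ (eq₁ E B))) (sym irr)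
    (m-n√5≥0 1ℚ m⁺ n (cancel-≤ _ (2 * B + 1) _ (eq₂ E B)
      (+-mono-≤ (*-monoʳ-≤ 4 l) (*-monoʳ-≤ 2 E≤B))))
  lower : ∀ j → x ≤√5 fromℤ j → + suc E ℤ.≤ j
  lower j x≤j = ≰⇒1+n≤ λ j≤E → <⇒≱ u (*-cancelˡ-≤ 4 (cancel-≤ _ 0 _ (eq₄ E B)
    (m-n√5≥0⁻ 1ℚ m⁻ n
      (subst (ι j ℚ.- κ n ℚ.* (-[1+ 1 ] ℚ./ 1) ℚ.≤_) (κ-double n E m⁻ (eq₃ E B))
        (ℚ.+-monoˡ-≤ _ (ι-mono-≤ j≤E)))
      (subst (λ q → NonNegative (ι j ℚ.- κ n ℚ.* (-[1+ 1 ] ℚ./ 1) +√5· q)) irr x≤j))))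

-- Assembly, by the last letter of the prefix

occurrences-b-prefix : ∀ n → occurrences (b ∷ []) (prefix n) ≡ #b (reverse (prefix n))
occurrences-b-prefix n = trans (occurrences-b (prefix n))
  (sym (trans (#b-ʳ++ (prefix n) []) (+-identityʳ _)))

occurrences-aa-prefix : ∀ n → occurrences (a ∷ a ∷ []) (prefix n) ≡ #aa (reverse (prefix n))
occurrences-aa-prefix n = trans (occurrences-aa (prefix n)) (sym (#aa-reverse (prefix n)))

length-prefix-# : ∀ n → n ≡ #a (reverse (prefix n)) + #b (reverse (prefix n))
length-prefix-# n = trans (sym (length-reverse-prefix n)) (length-# (reverse (prefix n)))

theorem1 : (n : ℕ) → .{{_ : NonZero n}} →
    (𝐟 n ≡ a → IsCeiling (fromℕ n ÷ φ ^ 2) (+ V n)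
    × V n ≡ occurrences (b ∷ []) (prefix n) + 1)
    × (𝐟 n ≡ b → IsCeiling (fromℕ n ÷ φ ^ 3) (+ V n)
    × V n ≡ occurrences (a ∷ a ∷ []) (prefix n) + 1)
theorem1 (suc n) = case-a , case-b
  where
  v = reverse (prefix n)

  case-a : 𝐟 (suc n) ≡ a → IsCeiling (fromℕ (suc n) ÷ φ ^ 2) (+ V (suc n))
                           × V (suc n) ≡ occurrences (b ∷ []) (prefix (suc n)) + 1
  case-a 𝐟≡a =
    subst₂ (λ k l → IsCeiling (fromℕ k ÷ φ ^ 2) (+ l)) (cong suc (sym (length-prefix-# n))) (sym V≡)
      (⌈n÷φ²⌉ (#a v) (#b v) (proj₁ bounds) (proj₂ bounds))
    , trans V≡ (trans (+-comm 1 _) (cong (_+ 1) (sym occ)))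
    where
    V≡ : V (suc n) ≡ suc (#b v)
    V≡ = V-∷ n 𝐟≡a
    bounds : Bounds a (#a v) (#b v)
    bounds = Pre-bounds (subst (Pre v) 𝐟≡a (Pre-prefix n))
    occ : occurrences (b ∷ []) (prefix (suc n)) ≡ #b v
    occ = trans (occurrences-b-prefix (suc n))
      (cong #b (trans (reverse-prefix n) (cong (_∷ v) 𝐟≡a)))

  case-b : 𝐟 (suc n) ≡ b → IsCeiling (fromℕ (suc n) ÷ φ ^ 3) (+ V (suc n))
                           × V (suc n) ≡ occurrences (a ∷ a ∷ []) (prefix (suc n)) + 1
  case-b 𝐟≡b =
    subst₂ (λ k l → IsCeiling (fromℕ k ÷ φ ^ 3) (+ l)) n≡ (sym V≡)
      -- The final b is included in `suc (#b v)`, and it adds no factor aa.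
      (⌈n÷φ³⌉ (#aa v) (suc (#b v))
        (subst (λ k → suc k >φ· suc (#b v)) #a≡ (proj₁ bounds))
        (subst (_<φ· suc (#b v)) #a≡ (proj₂ bounds)))
    , trans V≡ (trans (+-comm 1 _) (cong (_+ 1) (sym occ)))
    where
    V≡ : V (suc n) ≡ suc (#aa v)
    V≡ = V-∷ n 𝐟≡b
    p : Pre v b
    p = subst (Pre v) 𝐟≡b (Pre-prefix n)
    bounds : Bounds b (#a v) (#b v)
    bounds = Pre-bounds p
    #a≡ : #a v ≡ #aa v + suc (#b v)
    #a≡ = trans (#a-∷b (proj₂ (Pre-next p))) (+-comm (suc (#b v)) (#aa v))
    n≡ : #aa v + suc (#b v) + suc (#b v) ≡ suc n
    n≡ = trans (cong (_+ suc (#b v)) (sym #a≡))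
      (trans (+-suc (#a v) (#b v)) (cong suc (sym (length-prefix-# n))))
    occ : occurrences (a ∷ a ∷ []) (prefix (suc n)) ≡ #aa v
    occ = trans (occurrences-aa-prefix (suc n))
      (cong #aa (trans (reverse-prefix n) (cong (_∷ v) 𝐟≡b)))
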